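{- In the calculus described in the context, for all terms $r,s$ and every type $A$: if $r\to s$ and $r:A$, then $s:A$, where $\to$ is either the reduction relation $\hookrightarrow$ or the symmetric relation $\rightleftarrows$.
   Context: Types are given by the grammar $A,B,C ::= X \mid A\Rightarrow B \mid A\wedge B \mid \forall X.A$. The relation $\equiv$ on types is the equivalence relation (compatible with the type constructors) generated by $A\wedge B\equiv B\wedge A$, $(A\wedge B)\wedge C\equiv A\wedge(B\wedge C)$, and $A\Rightarrow(B\wedge C)\equiv (A\Rightarrow B)\wedge(A\Rightarrow C)$. Terms (every variable occurrence carries a type) are given by $r,s,t ::= x^A \mid \lambda x^A.r \mid r\,s \mid r+s \mid \pi_A(r) \mid \Lambda X.r \mid r\{A\}$; the same variable name with different type annotations counts as a different variable, and terms and types are taken up to $\alpha$-conversion. $r[s/x]$ is capture-avoiding term substitution and $r[A/X]$ is capture-avoiding substitution of a type for a type variable throughout $r$ (including type annotations). If the free variables of $r$ are $x_1^{A_1},\dots,x_n^{A_n}$, write $\Gamma(r)=\{A_1,\dots,A_n\}$. Typing judgements $r:A$ are derived by the rules: $x^A:A$; from $r:A$ and $A\equiv B$ infer $r:B$; from $r:B$ infer $\lambda x^A.r:A\Rightarrow B$; from $r:A\Rightarrow B$ and $s:A$ infer $r\,s:B$; from $r:A$ and $s:B$ infer $r+s:A\wedge B$; from $r:A\wedge B$ infer $\pi_A(r):A$; from $r:A$ with $X$ not free in any type of $\Gamma(r)$ infer $\Lambda X.r:\forall X.A$; from $r:\forall X.A$ infer $r\{B\}:A[B/X]$. The symmetric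 relation $\rightleftarrows$ on terms is given by the following rules (each usable in both directions): $r+s\rightleftarrows s+r$; $(r+s)+t\rightleftarrows r+(s+t)$; $(r+s)\,t\rightleftarrows r\,t+s\,t$; $\lambda x^A.(r+s)\rightleftarrows \lambda x^A.r+\lambda x^A.s$; and, whenever $r:A\Rightarrow(B\wedge C)$, $\pi_{A\Rightarrow B}(r)\,s\rightleftarrows \pi_B(r\,s)$. The reduction relation $\hookrightarrow$ is given by the rules: $(\lambda x^A.r)\,s\hookrightarrow r[s/x]$; $(\Lambda X.r)\{A\}\hookrightarrow r[A/X]$; and, whenever $r:A$, $\pi_A(r+s)\hookrightarrow r$. -}

module Defs where

open import Data.Nat using (ℕ; zero; suc; _+_; _≤_; compare; less; equal; greater)
open import Data.List using (List; []; _∷_; map)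
open import Data.Product using (_×_)
open import Data.Sum using (_⊎_)
open import Relation.Binary.PropositionalEquality using (_≡_)
open import Relation.Nullary using (¬_)

-- Types  A ::= X | A ⇒ B | A ∧ B | ∀X.A
-- Type variables are de Bruijn indices (so syntactic equality of types
-- is equality up to α-conversion); `∀̇ A` binds index 0 in A.

infixr 7 _⇒_
infixr 8 _∧_

data Type : Set where
  tv  : ℕ → Type
  _⇒_ : Type → Type → Type
  _∧_ : Type → Type → Type
  ∀̇   : Type → Type

extʳ : (ℕ → ℕ) → ℕ → ℕ
extʳ ρ zero    = zero
extʳ ρ (suc n) = suc (ρ n)

tren : (ℕ → ℕ) → Type → Type
tren ρ (tv n)  = tv (ρ n)
tren ρ (A ⇒ B) = tren ρ A ⇒ tren ρ B
tren ρ (A ∧ B) = tren ρ A ∧ tren ρ B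
tren ρ (∀̇ A)   = ∀̇ (tren (extʳ ρ) A)

extˢ : (ℕ → Type) → ℕ → Type
extˢ σ zero    = tv zero
extˢ σ (suc n) = tren suc (σ n)

tsub : (ℕ → Type) → Type → Type
tsub σ (tv n)  = σ n
tsub σ (A ⇒ B) = tsub σ A ⇒ tsub σ B
tsub σ (A ∧ B) = tsub σ A ∧ tsub σ B
tsub σ (∀̇ A)   = ∀̇ (tsub (extˢ σ) A)

single : Type → ℕ → Type
single B zero    = B
single B (suc n) = tv n

_[_]ᵗ : Type → Type → Type
A [ B ]ᵗ = tsub (single B) A

_∈FV_ : ℕ → Type → Set
x ∈FV tv y    = x ≡ y
x ∈FV (A ⇒ B) = (x ∈FV A) ⊎ (x ∈FV B)
x ∈FV (A ∧ B) = (x ∈FV A) ⊎ (x ∈FV B)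
x ∈FV ∀̇ A     = suc x ∈FV A

infix 4 _≅_
data _≅_ : Type → Type → Set where
  ≅-refl  : ∀ {A} → A ≅ A
  ≅-sym   : ∀ {A B} → A ≅ B → B ≅ A
  ≅-trans : ∀ {A B C} → A ≅ B → B ≅ C → A ≅ C
  ≅-⇒     : ∀ {A A′ B B′} → A ≅ A′ → B ≅ B′ → (A ⇒ B) ≅ (A′ ⇒ B′)
  ≅-∧     : ∀ {A A′ B B′} → A ≅ A′ → B ≅ B′ → (A ∧ B) ≅ (A′ ∧ B′)
  ≅-∀     : ∀ {A A′} → A ≅ A′ → ∀̇ A ≅ ∀̇ A′
  ≅-comm  : ∀ {A B} → (A ∧ B) ≅ (B ∧ A)
  ≅-assoc : ∀ {A B C} → ((A ∧ B) ∧ C) ≅ (A ∧ (B ∧ C))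
  ≅-dist  : ∀ {A B C} → (A ⇒ (B ∧ C)) ≅ ((A ⇒ B) ∧ (A ⇒ C))

-- Terms  r ::= x^A | λx^A.r | r s | r + s | π_A(r) | ΛX.r | r{A}
-- Term variables are de Bruijn indices counting the enclosing λ's
-- (Λ binds no term variable); every occurrence carries its type
-- annotation: `var n A` is x^A.  An occurrence `var n A` below fewer
-- than n+1 λ's is a free variable x^A; otherwise it refers to the
-- (n+1)-th enclosing λ, whose annotation must then be A (this is
-- checked by the typing relation; codes violating it correspond to no
-- named term and are untypable).

infixl 9 _·_
infixl 6 _⊕_

data Term : Set where
  var  : ℕ → Type → Term
  ƛ    : Type → Term → Term
  _·_  : Term → Term → Term
  _⊕_  : Term → Term → Term
  π    : Type → Term → Term
  Λ    : Term → Term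
  _⟪_⟫ : Term → Type → Term

ren : (ℕ → ℕ) → Term → Term
ren ρ (var n A)  = var (ρ n) A
ren ρ (ƛ A r)    = ƛ A (ren (extʳ ρ) r)
ren ρ (r · s)    = ren ρ r · ren ρ s
ren ρ (r ⊕ s)    = ren ρ r ⊕ ren ρ s
ren ρ (π A r)    = π A (ren ρ r)
ren ρ (Λ r)      = Λ (ren ρ r)
ren ρ (r ⟪ A ⟫)  = ren ρ r ⟪ A ⟫

Tren : (ℕ → ℕ) → Term → Term
Tren ρ (var n A)  = var n (tren ρ A)
Tren ρ (ƛ A r)    = ƛ (tren ρ A) (Tren ρ r)
Tren ρ (r · s)    = Tren ρ r · Tren ρ s
Tren ρ (r ⊕ s)    = Tren ρ r ⊕ Tren ρ s
Tren ρ (π A r)    = π (tren ρ A) (Tren ρ r)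
Tren ρ (Λ r)      = Λ (Tren (extʳ ρ) r)
Tren ρ (r ⟪ A ⟫)  = Tren ρ r ⟪ tren ρ A ⟫

Tsub : (ℕ → Type) → Term → Term
Tsub σ (var n A)  = var n (tsub σ A)
Tsub σ (ƛ A r)    = ƛ (tsub σ A) (Tsub σ r)
Tsub σ (r · s)    = Tsub σ r · Tsub σ s
Tsub σ (r ⊕ s)    = Tsub σ r ⊕ Tsub σ s
Tsub σ (π A r)    = π (tsub σ A) (Tsub σ r)
Tsub σ (Λ r)      = Λ (Tsub (extˢ σ) r)
Tsub σ (r ⟪ A ⟫)  = Tsub σ r ⟪ tsub σ A ⟫

_[_]ᵀ : Term → Type → Term
r [ B ]ᵀ = Tsub (single B) r

substVar : ℕ → Term → ℕ → Type → Term
substVar k s n A with compare n k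
... | less _ _    = var n A
... | equal _     = s
... | greater _ j = var (k + j) A

subst : ℕ → Term → Term → Term
subst k s (var n A)  = substVar k s n A
subst k s (ƛ A r)    = ƛ A (subst (suc k) (ren suc s) r)
subst k s (r · t)    = subst k s r · subst k s t
subst k s (r ⊕ t)    = subst k s r ⊕ subst k s t
subst k s (π A r)    = π A (subst k s r)
subst k s (Λ r)      = Λ (subst k (Tren suc s) r)
subst k s (r ⟪ A ⟫)  = subst k s r ⟪ A ⟫

-- r [ s ]  is  r[s/x]  where x is the variable bound by the λ whose body is r
_[_] : Term → Term → Term
r [ s ] = subst 0 s r

-- NoFreeIn d x r : type variable x does not occur free in the annotation
-- of any occurrence in r of a term variable that is free in r, where d is
-- the number of λ's of r traversed so far.
NoFreeIn : ℕ → ℕ → Term → Set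
NoFreeIn d x (var n A)  = d ≤ n → ¬ (x ∈FV A)
NoFreeIn d x (ƛ A r)    = NoFreeIn (suc d) x r
NoFreeIn d x (r · s)    = NoFreeIn d x r × NoFreeIn d x s
NoFreeIn d x (r ⊕ s)    = NoFreeIn d x r × NoFreeIn d x s
NoFreeIn d x (π A r)    = NoFreeIn d x r
NoFreeIn d x (Λ r)      = NoFreeIn d (suc x) r
NoFreeIn d x (r ⟪ A ⟫)  = NoFreeIn d x r

-- Typing.  Δ lists the annotations of the λ's enclosing the current
-- subterm *inside the term being typed* (innermost first); it is only
-- used to check that a bound occurrence carries its binder's annotation.

data _∋_⦂_ : List Type → ℕ → Type → Set where
  here  : ∀ {Δ A} → (A ∷ Δ) ∋ zero ⦂ A
  there : ∀ {Δ n A B} → Δ ∋ n ⦂ A → (B ∷ Δ) ∋ suc n ⦂ A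

infix 4 _⊢_∶_ _∶_
data _⊢_∶_ : List Type → Term → Type → Set where
  ⊢bound : ∀ {Δ n A} → Δ ∋ n ⦂ A → Δ ⊢ var n A ∶ A
  ⊢free  : ∀ {Δ n A} → Data.List.length Δ ≤ n → Δ ⊢ var n A ∶ A
  ⊢≅     : ∀ {Δ r A B} → Δ ⊢ r ∶ A → A ≅ B → Δ ⊢ r ∶ B
  ⊢ƛ     : ∀ {Δ r A B} → (A ∷ Δ) ⊢ r ∶ B → Δ ⊢ ƛ A r ∶ A ⇒ B
  ⊢·     : ∀ {Δ r s A B} → Δ ⊢ r ∶ A ⇒ B → Δ ⊢ s ∶ A → Δ ⊢ r · s ∶ B
  ⊢⊕     : ∀ {Δ r s A B} → Δ ⊢ r ∶ A → Δ ⊢ s ∶ B → Δ ⊢ r ⊕ s ∶ A ∧ B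
  ⊢π     : ∀ {Δ r A B} → Δ ⊢ r ∶ A ∧ B → Δ ⊢ π A r ∶ A
  ⊢Λ     : ∀ {Δ r A} → map (tren suc) Δ ⊢ r ∶ A → NoFreeIn 0 0 r → Δ ⊢ Λ r ∶ ∀̇ A
  ⊢⟪⟫    : ∀ {Δ r A B} → Δ ⊢ r ∶ ∀̇ A → Δ ⊢ r ⟪ B ⟫ ∶ A [ B ]ᵗ

_∶_ : Term → Type → Set
r ∶ A = [] ⊢ r ∶ A

infix 3 _⇄₀_ _⇄_ _↪_
data _⇄₀_ : Term → Term → Set where
  comm    : ∀ {r s} → r ⊕ s ⇄₀ s ⊕ r
  assoc   : ∀ {r s t} → (r ⊕ s) ⊕ t ⇄₀ r ⊕ (s ⊕ t)
  dist-·  : ∀ {r s t} → (r ⊕ s) · t ⇄₀ r · t ⊕ s · t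
  dist-ƛ  : ∀ {A r s} → ƛ A (r ⊕ s) ⇄₀ ƛ A r ⊕ ƛ A s
  dist-π  : ∀ {r s A B C} → r ∶ A ⇒ (B ∧ C) → π (A ⇒ B) r · s ⇄₀ π B (r · s)

_⇄_ : Term → Term → Set
r ⇄ s = (r ⇄₀ s) ⊎ (s ⇄₀ r)

data _↪_ : Term → Term → Set where
  β  : ∀ {A r s} → ƛ A r · s ↪ r [ s ]
  βᵀ : ∀ {r A} → Λ r ⟪ A ⟫ ↪ r [ A ]ᵀ
  π↪ : ∀ {r s A} → r ∶ A → π A (r ⊕ s) ↪ r

-- Subject reduction is proved by inversion of the typing rules, where every
-- inversion holds only up to ≅ since the conversion rule may be used
-- anywhere.  The key facts are that ≅ is injective on ⇒ and ∀, and that a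
-- type ≅ to an arrow D ⇒ B is a conjunction of arrows with domains ≅ D; both
-- are read off from `codomain`, `∀̇-body` and `ArrowsFrom D`, which respect
-- the three generating equations of ≅.  β and βᵀ then follow from the term
-- and type substitution lemmas, and the backward direction of the
-- distribution rules uses that a term has a unique type up to ≅.

module Submission where

open import Defs
open import Data.Empty using (⊥; ⊥-elim)
open import Data.List using (List; []; _∷_; _++_; length; map)
open import Data.List.Properties using (length-map; length-++; map-++; map-cong; map-∘)
open import Data.Nat using (ℕ; zero; suc; _+_; _≤_; _<_; z≤n; s≤s; s≤s⁻¹; compare; less; equal; greater)
open import Data.Nat.Properties using (≤-trans; m≤m+n; n≤1+n; <⇒≱; <-asym; <-irrefl; +-comm; suc-injective)
open import Data.Product using (_×_; _,_; proj₁; proj₂; ∃-syntax; swap; assocʳ′; assocˡ′; <_,_>)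
open import Data.Product.Function.NonDependent.Propositional using (_×-⇔_)
open import Data.Sum using (_⊎_; inj₁; inj₂)
open import Function using (_∘_; id)
open import Function.Bundles using (_⇔_; mk⇔; Equivalence)
open import Function.Construct.Composition using (_⇔-∘_)
open import Function.Construct.Identity using (⇔-id)
open import Function.Construct.Symmetry using (⇔-sym)
open import Relation.Nullary using (¬_)
open import Relation.Binary.PropositionalEquality as ≡
  using (_≡_; _≗_; refl; sym; trans; cong; cong₂)

private
  variable
    A A′ B B′ C D : Type
    Δ Δ′ : List Type
    r s : Term
    d k n x : ℕ

extʳ-cong : {ρ ρ′ : ℕ → ℕ} → ρ ≗ ρ′ → extʳ ρ ≗ extʳ ρ′
extʳ-cong e zero    = refl
extʳ-cong e (suc n) = cong suc (e n)

tren-cong : {ρ ρ′ : ℕ → ℕ} → ρ ≗ ρ′ → tren ρ ≗ tren ρ′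
tren-cong e (tv n)  = cong tv (e n)
tren-cong e (A ⇒ B) = cong₂ _⇒_ (tren-cong e A) (tren-cong e B)
tren-cong e (A ∧ B) = cong₂ _∧_ (tren-cong e A) (tren-cong e B)
tren-cong e (∀̇ A)   = cong ∀̇ (tren-cong (extʳ-cong e) A)

extˢ-cong : {σ σ′ : ℕ → Type} → σ ≗ σ′ → extˢ σ ≗ extˢ σ′
extˢ-cong e zero    = refl
extˢ-cong e (suc n) = cong (tren suc) (e n)

tsub-cong : {σ σ′ : ℕ → Type} → σ ≗ σ′ → tsub σ ≗ tsub σ′
tsub-cong e (tv n)  = e n
tsub-cong e (A ⇒ B) = cong₂ _⇒_ (tsub-cong e A) (tsub-cong e B)
tsub-cong e (A ∧ B) = cong₂ _∧_ (tsub-cong e A) (tsub-cong e B)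
tsub-cong e (∀̇ A)   = cong ∀̇ (tsub-cong (extˢ-cong e) A)

tren-tren : ∀ (ρ ρ′ : ℕ → ℕ) A → tren ρ (tren ρ′ A) ≡ tren (ρ ∘ ρ′) A
tren-tren ρ ρ′ (tv n)  = refl
tren-tren ρ ρ′ (A ⇒ B) = cong₂ _⇒_ (tren-tren ρ ρ′ A) (tren-tren ρ ρ′ B)
tren-tren ρ ρ′ (A ∧ B) = cong₂ _∧_ (tren-tren ρ ρ′ A) (tren-tren ρ ρ′ B)
tren-tren ρ ρ′ (∀̇ A)   =
  cong ∀̇ (trans (tren-tren (extʳ ρ) (extʳ ρ′) A) (tren-cong extʳ-∘ A))
  where
  extʳ-∘ : extʳ ρ ∘ extʳ ρ′ ≗ extʳ (ρ ∘ ρ′)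
  extʳ-∘ zero    = refl
  extʳ-∘ (suc n) = refl

tsub-tren : ∀ (σ : ℕ → Type) (ρ : ℕ → ℕ) A → tsub σ (tren ρ A) ≡ tsub (σ ∘ ρ) A
tsub-tren σ ρ (tv n)  = refl
tsub-tren σ ρ (A ⇒ B) = cong₂ _⇒_ (tsub-tren σ ρ A) (tsub-tren σ ρ B)
tsub-tren σ ρ (A ∧ B) = cong₂ _∧_ (tsub-tren σ ρ A) (tsub-tren σ ρ B)
tsub-tren σ ρ (∀̇ A)   =
  cong ∀̇ (trans (tsub-tren (extˢ σ) (extʳ ρ) A) (tsub-cong extˢ-∘-extʳ A))
  where
  extˢ-∘-extʳ : extˢ σ ∘ extʳ ρ ≗ extˢ (σ ∘ ρ)
  extˢ-∘-extʳ zero    = refl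
  extˢ-∘-extʳ (suc n) = refl

tren-tsub : ∀ (ρ : ℕ → ℕ) (σ : ℕ → Type) A → tren ρ (tsub σ A) ≡ tsub (tren ρ ∘ σ) A
tren-tsub ρ σ (tv n)  = refl
tren-tsub ρ σ (A ⇒ B) = cong₂ _⇒_ (tren-tsub ρ σ A) (tren-tsub ρ σ B)
tren-tsub ρ σ (A ∧ B) = cong₂ _∧_ (tren-tsub ρ σ A) (tren-tsub ρ σ B)
tren-tsub ρ σ (∀̇ A)   =
  cong ∀̇ (trans (tren-tsub (extʳ ρ) (extˢ σ) A) (tsub-cong tren-∘-extˢ A))
  where
  tren-∘-extˢ : tren (extʳ ρ) ∘ extˢ σ ≗ extˢ (tren ρ ∘ σ)
  tren-∘-extˢ zero    = refl
  tren-∘-extˢ (suc n) = trans (tren-tren (extʳ ρ) suc (σ n)) (sym (tren-tren suc ρ (σ n)))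

tsub-extˢ-tren-suc : ∀ (σ : ℕ → Type) A → tsub (extˢ σ) (tren suc A) ≡ tren suc (tsub σ A)
tsub-extˢ-tren-suc σ A = trans (tsub-tren (extˢ σ) suc A) (sym (tren-tsub suc σ A))

tsub-tsub : ∀ (σ τ : ℕ → Type) A → tsub σ (tsub τ A) ≡ tsub (tsub σ ∘ τ) A
tsub-tsub σ τ (tv n)  = refl
tsub-tsub σ τ (A ⇒ B) = cong₂ _⇒_ (tsub-tsub σ τ A) (tsub-tsub σ τ B)
tsub-tsub σ τ (A ∧ B) = cong₂ _∧_ (tsub-tsub σ τ A) (tsub-tsub σ τ B)
tsub-tsub σ τ (∀̇ A)   =
  cong ∀̇ (trans (tsub-tsub (extˢ σ) (extˢ τ) A) (tsub-cong tsub-∘-extˢ A))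
  where
  tsub-∘-extˢ : tsub (extˢ σ) ∘ extˢ τ ≗ extˢ (tsub σ ∘ τ)
  tsub-∘-extˢ zero    = refl
  tsub-∘-extˢ (suc n) = tsub-extˢ-tren-suc σ (τ n)

tsub-tv : ∀ A → tsub tv A ≡ A
tsub-tv (tv n)  = refl
tsub-tv (A ⇒ B) = cong₂ _⇒_ (tsub-tv A) (tsub-tv B)
tsub-tv (A ∧ B) = cong₂ _∧_ (tsub-tv A) (tsub-tv B)
tsub-tv (∀̇ A)   = cong ∀̇ (trans (tsub-cong extˢ-tv A) (tsub-tv A))
  where
  extˢ-tv : extˢ tv ≗ tv
  extˢ-tv zero    = refl
  extˢ-tv (suc n) = refl

tsub-[]ᵗ : ∀ (σ : ℕ → Type) A B → tsub σ (A [ B ]ᵗ) ≡ tsub (extˢ σ) A [ tsub σ B ]ᵗ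
tsub-[]ᵗ σ A B =
  trans (tsub-tsub σ (single B) A)
        (sym (trans (tsub-tsub (single (tsub σ B)) (extˢ σ) A) (tsub-cong single-∘-extˢ A)))
  where
  single-∘-extˢ : tsub (single (tsub σ B)) ∘ extˢ σ ≗ tsub σ ∘ single B
  single-∘-extˢ zero    = refl
  single-∘-extˢ (suc n) = trans (tsub-tren (single (tsub σ B)) suc (σ n)) (tsub-tv (σ n))

tren-as-tsub : ∀ (ρ : ℕ → ℕ) A → tren ρ A ≡ tsub (tv ∘ ρ) A
tren-as-tsub ρ (tv n)  = refl
tren-as-tsub ρ (A ⇒ B) = cong₂ _⇒_ (tren-as-tsub ρ A) (tren-as-tsub ρ B)
tren-as-tsub ρ (A ∧ B) = cong₂ _∧_ (tren-as-tsub ρ A) (tren-as-tsub ρ B)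
tren-as-tsub ρ (∀̇ A)   = cong ∀̇ (trans (tren-as-tsub (extʳ ρ) A) (tsub-cong tv-∘-extʳ A))
  where
  tv-∘-extʳ : tv ∘ extʳ ρ ≗ extˢ (tv ∘ ρ)
  tv-∘-extʳ zero    = refl
  tv-∘-extʳ (suc n) = refl

Tsub-cong : {σ σ′ : ℕ → Type} → σ ≗ σ′ → Tsub σ ≗ Tsub σ′
Tsub-cong e (var n A) = cong (var n) (tsub-cong e A)
Tsub-cong e (ƛ A r)   = cong₂ ƛ (tsub-cong e A) (Tsub-cong e r)
Tsub-cong e (r · s)   = cong₂ _·_ (Tsub-cong e r) (Tsub-cong e s)
Tsub-cong e (r ⊕ s)   = cong₂ _⊕_ (Tsub-cong e r) (Tsub-cong e s)
Tsub-cong e (π A r)   = cong₂ π (tsub-cong e A) (Tsub-cong e r)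
Tsub-cong e (Λ r)     = cong Λ (Tsub-cong (extˢ-cong e) r)
Tsub-cong e (r ⟪ A ⟫) = cong₂ _⟪_⟫ (Tsub-cong e r) (tsub-cong e A)

Tren-as-Tsub : ∀ (ρ : ℕ → ℕ) r → Tren ρ r ≡ Tsub (tv ∘ ρ) r
Tren-as-Tsub ρ (var n A) = cong (var n) (tren-as-tsub ρ A)
Tren-as-Tsub ρ (ƛ A r)   = cong₂ ƛ (tren-as-tsub ρ A) (Tren-as-Tsub ρ r)
Tren-as-Tsub ρ (r · s)   = cong₂ _·_ (Tren-as-Tsub ρ r) (Tren-as-Tsub ρ s)
Tren-as-Tsub ρ (r ⊕ s)   = cong₂ _⊕_ (Tren-as-Tsub ρ r) (Tren-as-Tsub ρ s)
Tren-as-Tsub ρ (π A r)   = cong₂ π (tren-as-tsub ρ A) (Tren-as-Tsub ρ r)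
Tren-as-Tsub ρ (Λ r)     = cong Λ (trans (Tren-as-Tsub (extʳ ρ) r) (Tsub-cong tv-∘-extʳ r))
  where
  tv-∘-extʳ : tv ∘ extʳ ρ ≗ extˢ (tv ∘ ρ)
  tv-∘-extʳ zero    = refl
  tv-∘-extʳ (suc n) = refl
Tren-as-Tsub ρ (r ⟪ A ⟫) = cong₂ _⟪_⟫ (Tren-as-Tsub ρ r) (tren-as-tsub ρ A)

tsub-≅ : ∀ (σ : ℕ → Type) → A ≅ B → tsub σ A ≅ tsub σ B
tsub-≅ σ ≅-refl          = ≅-refl
tsub-≅ σ (≅-sym e)       = ≅-sym (tsub-≅ σ e)
tsub-≅ σ (≅-trans e e′)  = ≅-trans (tsub-≅ σ e) (tsub-≅ σ e′)
tsub-≅ σ (≅-⇒ e e′)      = ≅-⇒ (tsub-≅ σ e) (tsub-≅ σ e′)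
tsub-≅ σ (≅-∧ e e′)      = ≅-∧ (tsub-≅ σ e) (tsub-≅ σ e′)
tsub-≅ σ (≅-∀ e)         = ≅-∀ (tsub-≅ (extˢ σ) e)
tsub-≅ σ ≅-comm          = ≅-comm
tsub-≅ σ ≅-assoc         = ≅-assoc
tsub-≅ σ ≅-dist          = ≅-dist

∈FV-tren⁻ : ∀ (ρ : ℕ → ℕ) A → x ∈FV tren ρ A → ∃[ y ] y ∈FV A × ρ y ≡ x
∈FV-tren⁻ ρ (tv n) p = n , refl , sym p
∈FV-tren⁻ ρ (A ⇒ B) (inj₁ p) = let (y , q , e) = ∈FV-tren⁻ ρ A p in y , inj₁ q , e
∈FV-tren⁻ ρ (A ⇒ B) (inj₂ p) = let (y , q , e) = ∈FV-tren⁻ ρ B p in y , inj₂ q , e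
∈FV-tren⁻ ρ (A ∧ B) (inj₁ p) = let (y , q , e) = ∈FV-tren⁻ ρ A p in y , inj₁ q , e
∈FV-tren⁻ ρ (A ∧ B) (inj₂ p) = let (y , q , e) = ∈FV-tren⁻ ρ B p in y , inj₂ q , e
∈FV-tren⁻ ρ (∀̇ A) p with ∈FV-tren⁻ (extʳ ρ) A p
... | suc y , q , e = y , q , suc-injective e

∈FV-tsub⁻ : ∀ (σ : ℕ → Type) A → x ∈FV tsub σ A → ∃[ y ] y ∈FV A × x ∈FV σ y
∈FV-tsub⁻ σ (tv n) p = n , refl , p
∈FV-tsub⁻ σ (A ⇒ B) (inj₁ p) = let (y , q , e) = ∈FV-tsub⁻ σ A p in y , inj₁ q , e
∈FV-tsub⁻ σ (A ⇒ B) (inj₂ p) = let (y , q , e) = ∈FV-tsub⁻ σ B p in y , inj₂ q , e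
∈FV-tsub⁻ σ (A ∧ B) (inj₁ p) = let (y , q , e) = ∈FV-tsub⁻ σ A p in y , inj₁ q , e
∈FV-tsub⁻ σ (A ∧ B) (inj₂ p) = let (y , q , e) = ∈FV-tsub⁻ σ B p in y , inj₂ q , e
∈FV-tsub⁻ σ (∀̇ A) p with ∈FV-tsub⁻ (extˢ σ) A p
... | suc y , q , e with ∈FV-tren⁻ suc (σ y) e
...   | _ , e′ , refl = y , q , e′

0∉FV-tren-suc : ∀ A → ¬ (0 ∈FV tren suc A)
0∉FV-tren-suc A p with ∈FV-tren⁻ suc A p
... | _ , _ , ()

NoFreeIn-Tsub : ∀ {σ : ℕ → Type} d r → (∀ y → x ∈FV σ y → NoFreeIn d y r) → NoFreeIn d x (Tsub σ r)
NoFreeIn-Tsub {σ = σ} d (var n A) h le p =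
  let (y , q , q′) = ∈FV-tsub⁻ σ A p in h y q′ le q
NoFreeIn-Tsub d (ƛ A r)   h = NoFreeIn-Tsub (suc d) r h
NoFreeIn-Tsub d (r · s)   h = NoFreeIn-Tsub d r (λ y → proj₁ ∘ h y) , NoFreeIn-Tsub d s (λ y → proj₂ ∘ h y)
NoFreeIn-Tsub d (r ⊕ s)   h = NoFreeIn-Tsub d r (λ y → proj₁ ∘ h y) , NoFreeIn-Tsub d s (λ y → proj₂ ∘ h y)
NoFreeIn-Tsub d (π A r)   h = NoFreeIn-Tsub d r h
NoFreeIn-Tsub {x = x} {σ = σ} d (Λ r) h = NoFreeIn-Tsub d r h′
  where
  h′ : ∀ y → suc x ∈FV extˢ σ y → NoFreeIn d y r
  h′ (suc y) p with ∈FV-tren⁻ suc (σ y) p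
  ... | _ , q , refl = h y q
NoFreeIn-Tsub d (r ⟪ A ⟫) h = NoFreeIn-Tsub d r h

NoFreeIn-Tren-suc : ∀ s → NoFreeIn d x s → NoFreeIn d (suc x) (Tren suc s)
NoFreeIn-Tren-suc {d} {x} s h =
  ≡.subst (NoFreeIn d (suc x)) (sym (Tren-as-Tsub suc s)) (NoFreeIn-Tsub d s λ { _ refl → h })

NoFreeIn-0-Tren-suc : ∀ s → NoFreeIn d 0 (Tren suc s)
NoFreeIn-0-Tren-suc {d} s =
  ≡.subst (NoFreeIn d 0) (sym (Tren-as-Tsub suc s)) (NoFreeIn-Tsub d s λ _ ())

NoFreeIn-ren : ∀ {ρ : ℕ → ℕ} {d′} r → (∀ n → d′ ≤ ρ n → d ≤ n) → NoFreeIn d x r → NoFreeIn d′ x (ren ρ r)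
NoFreeIn-ren (var n A) c h le = h (c n le)
NoFreeIn-ren {d} {ρ = ρ} {d′} (ƛ A r) c h = NoFreeIn-ren r c′ h
  where
  c′ : ∀ n → suc d′ ≤ extʳ ρ n → suc d ≤ n
  c′ (suc n) (s≤s le) = s≤s (c n le)
NoFreeIn-ren (r · s)   c (h , h′) = NoFreeIn-ren r c h , NoFreeIn-ren s c h′
NoFreeIn-ren (r ⊕ s)   c (h , h′) = NoFreeIn-ren r c h , NoFreeIn-ren s c h′
NoFreeIn-ren (π A r)   c h = NoFreeIn-ren r c h
NoFreeIn-ren (Λ r)     c h = NoFreeIn-ren r c h
NoFreeIn-ren (r ⟪ A ⟫) c h = NoFreeIn-ren r c h

NoFreeIn-subst : ∀ k s r → NoFreeIn d x r → NoFreeIn d x s → NoFreeIn d x (subst k s r)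
NoFreeIn-subst k s (var n A) h hs with compare n k
... | less _ _    = h
... | equal _     = hs
... | greater _ j = λ le → h (≤-trans le (n≤1+n _))
NoFreeIn-subst k s (ƛ A r) h hs = NoFreeIn-subst (suc k) (ren suc s) r h (NoFreeIn-ren s (λ _ → s≤s⁻¹) hs)
NoFreeIn-subst k s (r · t)   (h , h′) hs = NoFreeIn-subst k s r h hs , NoFreeIn-subst k s t h′ hs
NoFreeIn-subst k s (r ⊕ t)   (h , h′) hs = NoFreeIn-subst k s r h hs , NoFreeIn-subst k s t h′ hs
NoFreeIn-subst k s (π A r)   h hs = NoFreeIn-subst k s r h hs
NoFreeIn-subst k s (Λ r)     h hs = NoFreeIn-subst k (Tren suc s) r h (NoFreeIn-Tren-suc s hs)
NoFreeIn-subst k s (r ⟪ A ⟫) h hs = NoFreeIn-subst k s r h hs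

∋-map : (f : Type → Type) → Δ ∋ n ⦂ A → map f Δ ∋ n ⦂ f A
∋-map f here      = here
∋-map f (there p) = there (∋-map f p)

∋-map⁻ : (f : Type → Type) → map f Δ ∋ n ⦂ A → ∃[ C ] Δ ∋ n ⦂ C × f C ≡ A
∋-map⁻ {_ ∷ _} f here      = _ , here , refl
∋-map⁻ {_ ∷ _} f (there p) = let (C , q , e) = ∋-map⁻ f p in C , there q , e

∋-++-≤ : (Δ ++ A ∷ []) ∋ n ⦂ C → n ≤ length Δ
∋-++-≤ {[]}    here      = z≤n
∋-++-≤ {_ ∷ _} here      = z≤n
∋-++-≤ {_ ∷ _} (there p) = s≤s (∋-++-≤ p)

∋-++⁻ˡ : (Δ ++ A ∷ []) ∋ n ⦂ C → n < length Δ → Δ ∋ n ⦂ C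
∋-++⁻ˡ {_ ∷ _} here      _        = here
∋-++⁻ˡ {_ ∷ _} (there p) (s≤s lt) = there (∋-++⁻ˡ p lt)

∋-++-last : (Δ ++ A ∷ []) ∋ n ⦂ C → n ≡ length Δ → C ≡ A
∋-++-last {[]}    here      _ = refl
∋-++-last {_ ∷ _} (there p) e = ∋-++-last p (suc-injective e)

-- Typing under renaming and substitution

⊢-ren : ∀ {ρ : ℕ → ℕ} → (∀ {n C} → Δ ∋ n ⦂ C → Δ′ ∋ ρ n ⦂ C) →
        (∀ {n} → length Δ ≤ n → length Δ′ ≤ ρ n) → Δ ⊢ r ∶ A → Δ′ ⊢ ren ρ r ∶ A
⊢-ren f g (⊢bound p) = ⊢bound (f p)
⊢-ren f g (⊢free le) = ⊢free (g le)
⊢-ren f g (⊢≅ d e)   = ⊢≅ (⊢-ren f g d) e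
⊢-ren {Δ} {Δ′} {ρ = ρ} f g (⊢ƛ {A = C} d) = ⊢ƛ (⊢-ren f′ g′ d)
  where
  f′ : ∀ {n D} → (C ∷ Δ) ∋ n ⦂ D → (C ∷ Δ′) ∋ extʳ ρ n ⦂ D
  f′ here      = here
  f′ (there p) = there (f p)
  g′ : ∀ {n} → suc (length Δ) ≤ n → suc (length Δ′) ≤ extʳ ρ n
  g′ {suc n} (s≤s le) = s≤s (g le)
⊢-ren f g (⊢· d d′) = ⊢· (⊢-ren f g d) (⊢-ren f g d′)
⊢-ren f g (⊢⊕ d d′) = ⊢⊕ (⊢-ren f g d) (⊢-ren f g d′)
⊢-ren f g (⊢π d)    = ⊢π (⊢-ren f g d)
⊢-ren {Δ} {Δ′} {ρ = ρ} f g (⊢Λ {r = r} d nf) = ⊢Λ (⊢-ren f′ g′ d) (NoFreeIn-ren r (λ _ _ → z≤n) nf)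
  where
  f′ : ∀ {n D} → map (tren suc) Δ ∋ n ⦂ D → map (tren suc) Δ′ ∋ ρ n ⦂ D
  f′ p with ∋-map⁻ (tren suc) p
  ... | _ , q , refl = ∋-map (tren suc) (f q)
  g′ : ∀ {n} → length (map (tren suc) Δ) ≤ n → length (map (tren suc) Δ′) ≤ ρ n
  g′ le rewrite length-map (tren suc) Δ | length-map (tren suc) Δ′ = g le
⊢-ren f g (⊢⟪⟫ d) = ⊢⟪⟫ (⊢-ren f g d)

⊢-Tsub : ∀ (σ : ℕ → Type) → Δ ⊢ r ∶ A → map (tsub σ) Δ ⊢ Tsub σ r ∶ tsub σ A
⊢-Tsub σ (⊢bound p)  = ⊢bound (∋-map (tsub σ) p)
⊢-Tsub {Δ} σ (⊢free le) = ⊢free (≡.subst (_≤ _) (sym (length-map (tsub σ) Δ)) le)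
⊢-Tsub σ (⊢≅ d e)    = ⊢≅ (⊢-Tsub σ d) (tsub-≅ σ e)
⊢-Tsub σ (⊢ƛ d)      = ⊢ƛ (⊢-Tsub σ d)
⊢-Tsub σ (⊢· d d′)   = ⊢· (⊢-Tsub σ d) (⊢-Tsub σ d′)
⊢-Tsub σ (⊢⊕ d d′)   = ⊢⊕ (⊢-Tsub σ d) (⊢-Tsub σ d′)
⊢-Tsub σ (⊢π d)      = ⊢π (⊢-Tsub σ d)
⊢-Tsub {Δ} σ (⊢Λ {r = r} {A = A} d nf) =
  ⊢Λ (≡.subst (λ Γ → Γ ⊢ Tsub (extˢ σ) r ∶ tsub (extˢ σ) A) weaken-tsub (⊢-Tsub (extˢ σ) d))
     (NoFreeIn-Tsub 0 r only-0)
  where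
  weaken-tsub : map (tsub (extˢ σ)) (map (tren suc) Δ) ≡ map (tren suc) (map (tsub σ) Δ)
  weaken-tsub = trans (sym (map-∘ Δ)) (trans (map-cong (tsub-extˢ-tren-suc σ) Δ) (map-∘ Δ))
  only-0 : ∀ y → 0 ∈FV extˢ σ y → NoFreeIn 0 y r
  only-0 zero    _ = nf
  only-0 (suc y) p = ⊥-elim (0∉FV-tren-suc (σ y) p)
⊢-Tsub {Δ} σ (⊢⟪⟫ {r = r} {A = A} {B = B} d) =
  ≡.subst (map (tsub σ) Δ ⊢ Tsub σ r ⟪ tsub σ B ⟫ ∶_) (sym (tsub-[]ᵗ σ A B)) (⊢⟪⟫ (⊢-Tsub σ d))

⊢-Tren-suc : Δ ⊢ s ∶ A → map (tren suc) Δ ⊢ Tren suc s ∶ tren suc A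
⊢-Tren-suc {Δ} {s} {A} d
  rewrite Tren-as-Tsub suc s | tren-as-tsub suc A | map-cong (tren-as-tsub suc) Δ = ⊢-Tsub (tv ∘ suc) d

⊢-substBound : length Δ ≡ k → (Δ ++ A ∷ []) ∋ n ⦂ C → Δ ⊢ s ∶ A → Δ ⊢ substVar k s n C ∶ C
⊢-substBound {Δ} {k} {n = n} eq p ds with compare n k
... | less _ j    = ⊢bound (∋-++⁻ˡ p (≡.subst (n <_) (sym eq) (s≤s (m≤m+n n j))))
... | equal _ rewrite ∋-++-last p (sym eq) = ds
... | greater _ j = ⊥-elim (<⇒≱ (s≤s (m≤m+n k j)) (≡.subst (n ≤_) eq (∋-++-≤ p)))

⊢-substFree : length Δ ≡ k → k < n → Δ ⊢ substVar k s n C ∶ C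
⊢-substFree {k = k} {n} eq k<n with compare n k
... | less _ j    = ⊥-elim (<-asym (s≤s (m≤m+n n j)) k<n)
... | equal _     = ⊥-elim (<-irrefl refl k<n)
... | greater _ j = ⊢free (≡.subst (_≤ k + j) (sym eq) (m≤m+n k j))

⊢-subst : length Δ ≡ k → (Δ ++ A ∷ []) ⊢ r ∶ B → Δ ⊢ s ∶ A → Δ ⊢ subst k s r ∶ B
⊢-subst eq (⊢bound p) ds = ⊢-substBound eq p ds
⊢-subst {Δ} eq (⊢free le) ds =
  ⊢-substFree eq (≡.subst (_≤ _) (trans (length-++ Δ) (trans (+-comm (length Δ) 1) (cong suc eq))) le)
⊢-subst eq (⊢≅ d e)  ds = ⊢≅ (⊢-subst eq d ds) e
⊢-subst eq (⊢ƛ d)    ds = ⊢ƛ (⊢-subst (cong suc eq) d (⊢-ren there s≤s ds))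
⊢-subst eq (⊢· d d′) ds = ⊢· (⊢-subst eq d ds) (⊢-subst eq d′ ds)
⊢-subst eq (⊢⊕ d d′) ds = ⊢⊕ (⊢-subst eq d ds) (⊢-subst eq d′ ds)
⊢-subst eq (⊢π d)    ds = ⊢π (⊢-subst eq d ds)
⊢-subst {Δ} {k} {A} {s = s} eq (⊢Λ {r = r} {A = B} d nf) ds =
  ⊢Λ (⊢-subst (trans (length-map (tren suc) Δ) eq)
              (≡.subst (_⊢ r ∶ B) (map-++ (tren suc) Δ (A ∷ [])) d) (⊢-Tren-suc ds))
     (NoFreeIn-subst k (Tren suc s) r nf (NoFreeIn-0-Tren-suc s))
⊢-subst eq (⊢⟪⟫ d)   ds = ⊢⟪⟫ (⊢-subst eq d ds)

-- Invariants of ≅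

codomain : Type → Type
codomain (A ⇒ B) = B
codomain (A ∧ B) = codomain A ∧ codomain B
codomain A       = A

codomain-≅ : A ≅ B → codomain A ≅ codomain B
codomain-≅ ≅-refl         = ≅-refl
codomain-≅ (≅-sym e)      = ≅-sym (codomain-≅ e)
codomain-≅ (≅-trans e e′) = ≅-trans (codomain-≅ e) (codomain-≅ e′)
codomain-≅ (≅-⇒ _ e)      = e
codomain-≅ (≅-∧ e e′)     = ≅-∧ (codomain-≅ e) (codomain-≅ e′)
codomain-≅ (≅-∀ e)        = ≅-∀ e
codomain-≅ ≅-comm         = ≅-comm
codomain-≅ ≅-assoc        = ≅-assoc
codomain-≅ ≅-dist         = ≅-refl

∀̇-body : Type → Type
∀̇-body (∀̇ A)   = A
∀̇-body (A ∧ B) = ∀̇-body A ∧ ∀̇-body B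
∀̇-body A       = A

∀̇-body-≅ : A ≅ B → ∀̇-body A ≅ ∀̇-body B
∀̇-body-≅ ≅-refl         = ≅-refl
∀̇-body-≅ (≅-sym e)      = ≅-sym (∀̇-body-≅ e)
∀̇-body-≅ (≅-trans e e′) = ≅-trans (∀̇-body-≅ e) (∀̇-body-≅ e′)
∀̇-body-≅ (≅-⇒ e e′)     = ≅-⇒ e e′
∀̇-body-≅ (≅-∧ e e′)     = ≅-∧ (∀̇-body-≅ e) (∀̇-body-≅ e′)
∀̇-body-≅ (≅-∀ e)        = e
∀̇-body-≅ ≅-comm         = ≅-comm
∀̇-body-≅ ≅-assoc        = ≅-assoc
∀̇-body-≅ ≅-dist         = ≅-dist

ArrowsFrom : Type → Type → Set
ArrowsFrom D (tv _)  = ⊥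
ArrowsFrom D (A ⇒ _) = A ≅ D
ArrowsFrom D (A ∧ B) = ArrowsFrom D A × ArrowsFrom D B
ArrowsFrom D (∀̇ _)   = ⊥

ArrowsFrom-≅ : A ≅ B → ArrowsFrom D A ⇔ ArrowsFrom D B
ArrowsFrom-≅ ≅-refl         = ⇔-id _
ArrowsFrom-≅ (≅-sym e)      = ⇔-sym (ArrowsFrom-≅ e)
ArrowsFrom-≅ (≅-trans e e′) = ArrowsFrom-≅ e′ ⇔-∘ ArrowsFrom-≅ e
ArrowsFrom-≅ (≅-⇒ e _)      = mk⇔ (≅-trans (≅-sym e)) (≅-trans e)
ArrowsFrom-≅ (≅-∧ e e′)     = ArrowsFrom-≅ e ×-⇔ ArrowsFrom-≅ e′
ArrowsFrom-≅ (≅-∀ _)        = ⇔-id _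
ArrowsFrom-≅ ≅-comm         = mk⇔ swap swap
ArrowsFrom-≅ ≅-assoc        = mk⇔ assocʳ′ assocˡ′
ArrowsFrom-≅ ≅-dist         = mk⇔ < id , id > proj₁

≅-⇒-arrowsFrom : C ≅ D ⇒ B → ArrowsFrom D C
≅-⇒-arrowsFrom e = Equivalence.from (ArrowsFrom-≅ e) ≅-refl

arrowsFrom-≅-⇒ : ∀ C → ArrowsFrom D C → C ≅ D ⇒ codomain C
arrowsFrom-≅-⇒ (A ⇒ B) h        = ≅-⇒ h ≅-refl
arrowsFrom-≅-⇒ (A ∧ B) (h , h′) = ≅-trans (≅-∧ (arrowsFrom-≅-⇒ A h) (arrowsFrom-≅-⇒ B h′)) (≅-sym ≅-dist)

≅-⇒-injectiveˡ : A ⇒ B ≅ A′ ⇒ B′ → A ≅ A′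
≅-⇒-injectiveˡ e = ≅-sym (≅-⇒-arrowsFrom (≅-sym e))

≅-⇒-injectiveʳ : A ⇒ B ≅ A′ ⇒ B′ → B ≅ B′
≅-⇒-injectiveʳ = codomain-≅

≅-∀̇-injective : ∀̇ A ≅ ∀̇ A′ → A ≅ A′
≅-∀̇-injective = ∀̇-body-≅

-- Inversion

⊢ƛ⁻¹ : Δ ⊢ ƛ A r ∶ C → ∃[ B ] (A ∷ Δ) ⊢ r ∶ B × A ⇒ B ≅ C
⊢ƛ⁻¹ (⊢ƛ d)   = _ , d , ≅-refl
⊢ƛ⁻¹ (⊢≅ d e) = let (B , d′ , e′) = ⊢ƛ⁻¹ d in B , d′ , ≅-trans e′ e

⊢·⁻¹ : Δ ⊢ r · s ∶ C → ∃[ A ] ∃[ B ] Δ ⊢ r ∶ A ⇒ B × Δ ⊢ s ∶ A × B ≅ C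
⊢·⁻¹ (⊢· d d′) = _ , _ , d , d′ , ≅-refl
⊢·⁻¹ (⊢≅ d e)  = let (A , B , d₁ , d₂ , e′) = ⊢·⁻¹ d in A , B , d₁ , d₂ , ≅-trans e′ e

⊢⊕⁻¹ : Δ ⊢ r ⊕ s ∶ C → ∃[ A ] ∃[ B ] Δ ⊢ r ∶ A × Δ ⊢ s ∶ B × A ∧ B ≅ C
⊢⊕⁻¹ (⊢⊕ d d′) = _ , _ , d , d′ , ≅-refl
⊢⊕⁻¹ (⊢≅ d e)  = let (A , B , d₁ , d₂ , e′) = ⊢⊕⁻¹ d in A , B , d₁ , d₂ , ≅-trans e′ e

⊢π⁻¹ : Δ ⊢ π A r ∶ C → ∃[ B ] Δ ⊢ r ∶ A ∧ B × A ≅ C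
⊢π⁻¹ (⊢π d)   = _ , d , ≅-refl
⊢π⁻¹ (⊢≅ d e) = let (B , d′ , e′) = ⊢π⁻¹ d in B , d′ , ≅-trans e′ e

⊢Λ⁻¹ : Δ ⊢ Λ r ∶ C → ∃[ A ] map (tren suc) Δ ⊢ r ∶ A × ∀̇ A ≅ C
⊢Λ⁻¹ (⊢Λ d _) = _ , d , ≅-refl
⊢Λ⁻¹ (⊢≅ d e) = let (A , d′ , e′) = ⊢Λ⁻¹ d in A , d′ , ≅-trans e′ e

⊢⟪⟫⁻¹ : Δ ⊢ r ⟪ B ⟫ ∶ C → ∃[ A ] Δ ⊢ r ∶ ∀̇ A × A [ B ]ᵗ ≅ C
⊢⟪⟫⁻¹ (⊢⟪⟫ d)  = _ , d , ≅-refl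
⊢⟪⟫⁻¹ (⊢≅ d e) = let (A , d′ , e′) = ⊢⟪⟫⁻¹ d in A , d′ , ≅-trans e′ e

⊢var⁻¹ : Δ ⊢ var n A ∶ C → A ≅ C
⊢var⁻¹ (⊢bound _) = ≅-refl
⊢var⁻¹ (⊢free _)  = ≅-refl
⊢var⁻¹ (⊢≅ d e)   = ≅-trans (⊢var⁻¹ d) e

⊢-unique : Δ ⊢ r ∶ A → Δ ⊢ r ∶ B → A ≅ B
⊢-unique (⊢bound _) d′ = ⊢var⁻¹ d′
⊢-unique (⊢free _)  d′ = ⊢var⁻¹ d′
⊢-unique (⊢≅ d e)   d′ = ≅-trans (≅-sym e) (⊢-unique d d′)
⊢-unique (⊢ƛ d) d′ =
  let (_ , d″ , e) = ⊢ƛ⁻¹ d′ in ≅-trans (≅-⇒ ≅-refl (⊢-unique d d″)) e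
⊢-unique (⊢· d _) d′ =
  let (_ , _ , d″ , _ , e) = ⊢·⁻¹ d′ in ≅-trans (≅-⇒-injectiveʳ (⊢-unique d d″)) e
⊢-unique (⊢⊕ d₁ d₂) d′ =
  let (_ , _ , d₁′ , d₂′ , e) = ⊢⊕⁻¹ d′ in ≅-trans (≅-∧ (⊢-unique d₁ d₁′) (⊢-unique d₂ d₂′)) e
⊢-unique (⊢π _) d′ = proj₂ (proj₂ (⊢π⁻¹ d′))
⊢-unique (⊢Λ d _) d′ =
  let (_ , d″ , e) = ⊢Λ⁻¹ d′ in ≅-trans (≅-∀ (⊢-unique d d″)) e
⊢-unique (⊢⟪⟫ {B = B} d) d′ =
  let (_ , d″ , e) = ⊢⟪⟫⁻¹ d′ in ≅-trans (tsub-≅ (single B) (≅-∀̇-injective (⊢-unique d d″))) e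

↪-preserves-⊢ : r ↪ s → r ∶ A → s ∶ A
↪-preserves-⊢ β d =
  let (_ , _ , dƛ , ds , e) = ⊢·⁻¹ d
      (_ , dr , e′)         = ⊢ƛ⁻¹ dƛ
  in ⊢≅ (⊢-subst refl dr (⊢≅ ds (≅-sym (≅-⇒-injectiveˡ e′)))) (≅-trans (≅-⇒-injectiveʳ e′) e)
↪-preserves-⊢ (βᵀ {A = B}) d =
  let (_ , dΛ , e) = ⊢⟪⟫⁻¹ d
      (_ , dr , e′) = ⊢Λ⁻¹ dΛ
  in ⊢≅ (⊢-Tsub (single B) dr) (≅-trans (tsub-≅ (single B) (≅-∀̇-injective e′)) e)
↪-preserves-⊢ (π↪ dr) d = ⊢≅ dr (proj₂ (proj₂ (⊢π⁻¹ d)))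

⇄₀-preserves-⊢ : r ⇄₀ s → r ∶ A → s ∶ A
⇄₀-preserves-⊢ comm d =
  let (_ , _ , dr , ds , e) = ⊢⊕⁻¹ d in ⊢≅ (⊢⊕ ds dr) (≅-trans ≅-comm e)
⇄₀-preserves-⊢ assoc d =
  let (_ , _ , drs , dt , e) = ⊢⊕⁻¹ d
      (_ , _ , dr , ds , e′) = ⊢⊕⁻¹ drs
  in ⊢≅ (⊢⊕ dr (⊢⊕ ds dt)) (≅-trans (≅-sym ≅-assoc) (≅-trans (≅-∧ e′ ≅-refl) e))
⇄₀-preserves-⊢ dist-· d =
  let (_ , _ , drs , dt , e) = ⊢·⁻¹ d
      (C , E , dr , ds , e′) = ⊢⊕⁻¹ drs
      (hr , hs)              = ≅-⇒-arrowsFrom e′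
  in ⊢≅ (⊢⊕ (⊢· (⊢≅ dr (arrowsFrom-≅-⇒ C hr)) dt) (⊢· (⊢≅ ds (arrowsFrom-≅-⇒ E hs)) dt))
        (≅-trans (codomain-≅ e′) e)
⇄₀-preserves-⊢ dist-ƛ d =
  let (_ , drs , e)          = ⊢ƛ⁻¹ d
      (_ , _ , dr , ds , e′) = ⊢⊕⁻¹ drs
  in ⊢≅ (⊢⊕ (⊢ƛ dr) (⊢ƛ ds)) (≅-trans (≅-sym ≅-dist) (≅-trans (≅-⇒ ≅-refl e′) e))
⇄₀-preserves-⊢ (dist-π dr) d =
  let (_ , _ , dπ , ds , e) = ⊢·⁻¹ d
      (_ , _ , e′)          = ⊢π⁻¹ dπ
  in ⊢≅ (⊢π (⊢· dr (⊢≅ ds (≅-sym (≅-⇒-injectiveˡ e′))))) (≅-trans (≅-⇒-injectiveʳ e′) e)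

⇄₀-reflects-⊢ : r ⇄₀ s → s ∶ A → r ∶ A
⇄₀-reflects-⊢ comm d =
  let (_ , _ , ds , dr , e) = ⊢⊕⁻¹ d in ⊢≅ (⊢⊕ dr ds) (≅-trans ≅-comm e)
⇄₀-reflects-⊢ assoc d =
  let (_ , _ , dr , dst , e) = ⊢⊕⁻¹ d
      (_ , _ , ds , dt , e′) = ⊢⊕⁻¹ dst
  in ⊢≅ (⊢⊕ (⊢⊕ dr ds) dt) (≅-trans ≅-assoc (≅-trans (≅-∧ ≅-refl e′) e))
⇄₀-reflects-⊢ dist-· d =
  let (_ , _ , drt , dst , e) = ⊢⊕⁻¹ d
      (_ , _ , dr , dt , e₁)  = ⊢·⁻¹ drt
      (_ , _ , ds , dt′ , e₂) = ⊢·⁻¹ dst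
      ds′ = ⊢≅ ds (≅-⇒ (⊢-unique dt′ dt) ≅-refl)
  in ⊢≅ (⊢· (⊢≅ (⊢⊕ dr ds′) (≅-sym ≅-dist)) dt) (≅-trans (≅-∧ e₁ e₂) e)
⇄₀-reflects-⊢ dist-ƛ d =
  let (_ , _ , dr , ds , e) = ⊢⊕⁻¹ d
      (_ , dr′ , e₁)        = ⊢ƛ⁻¹ dr
      (_ , ds′ , e₂)        = ⊢ƛ⁻¹ ds
  in ⊢≅ (⊢ƛ (⊢⊕ dr′ ds′)) (≅-trans ≅-dist (≅-trans (≅-∧ e₁ e₂) e))
⇄₀-reflects-⊢ (dist-π dr) d =
  let (_ , drs , e)          = ⊢π⁻¹ d
      (_ , _ , dr′ , ds , _) = ⊢·⁻¹ drs
  in ⊢≅ (⊢· (⊢π (⊢≅ dr ≅-dist)) (⊢≅ ds (≅-⇒-injectiveˡ (⊢-unique dr′ dr)))) e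

theorem3 : (r s : Term) (A : Type) → (r ↪ s) ⊎ (r ⇄ s) → r ∶ A → s ∶ A
theorem3 r s A (inj₁ r↪s)        = ↪-preserves-⊢ r↪s
theorem3 r s A (inj₂ (inj₁ r⇄s)) = ⇄₀-preserves-⊢ r⇄s
theorem3 r s A (inj₂ (inj₂ s⇄r)) = ⇄₀-reflects-⊢ s⇄r
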